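{- Let $\mathbb{F}_q$ be a finite field with $q$ elements and let $n$ be a positive integer. Let $\alpha, \beta, \gamma \in \mathbb{F}_q$ satisfy $\alpha + \beta + \gamma = 0$ and $\gamma \neq 0$. Let $A$ be a subset of $\mathbb{F}_q^n$ such that the equation $$\alpha a_1 + \beta a_2 + \gamma a_3 = 0$$ has no solutions $(a_1,a_2,a_3) \in A^3$ apart from those with $a_1=a_2=a_3$. Then $$|A| \leq 3\, m_{(q-1)n/3},$$ where, for a real number $d$, $m_d$ denotes the number of monomials in $x_1,\ldots,x_n$ with total degree at most $d$ in which each variable appears with degree at most $q-1$.
   Context: For fixed $q$ and $n$ and a real number $d \ge 0$, $m_d$ is the number of tuples $(e_1,\ldots,e_n)$ of integers with $0 \le e_i \le q-1$ for all $i$ and $e_1+\cdots+e_n \le d$ (the exponent tuples of the monomials $x_1^{e_1}\cdots x_n^{e_n}$). The index $d=(q-1)n/3$ is a real number and need not be an integer. -}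

module Defs where

open import Algebra.Apartness.Bundles using (HeytingField)
open import Data.Fin.Base using (Fin; toℕ; finToFun)
open import Data.Integer.Base using (+_)
open import Data.List.Base using (List; allFin; filter; length; map)
open import Data.Nat.Base using (ℕ; _^_; +-0-rawMonoid)
open import Data.Product.Base using (proj₁; _×_; ∃)
open import Data.Rational using (ℚ; _/_; _≤?_)
open import Data.Vec.Functional using (Vector; zipWith; replicate)
import Data.Vec.Functional as Vector
import Data.Vec.Functional.Relation.Binary.Equality.Setoid as VectorEquality
open import Function.Bundles using (Inverse)
open import Level using (Level; _⊔_)
open import Relation.Binary.Bundles using (Setoid)
import Relation.Binary.Construct.On as On
open import Relation.Binary.PropositionalEquality using (setoid)
open import Relation.Unary using (Pred)
open import Algebra.Definitions.RawMonoid +-0-rawMonoid using (sum)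

private
  variable
    a ℓ p : Level

HasCardinality : Setoid a ℓ → ℕ → Set (a ⊔ ℓ)
HasCardinality S k = Inverse S (setoid (Fin k))

-- Elements of the subset are compared as elements of S, so membership proofs
-- do not affect the cardinality.
subsetSetoid : (S : Setoid a ℓ) → Pred (Setoid.Carrier S) p → Setoid (a ⊔ p) ℓ
subsetSetoid S P = On.setoid {B = ∃ P} S proj₁

-- finToFun is a bijection from Fin (q ^ n) onto these tuples (up to pointwise
-- equality), so each tuple with entries in {0, …, q - 1} is listed exactly once.
exponentTuples : (q n : ℕ) → List (Vector (Fin q) n)
exponentTuples q n = map finToFun (allFin (q ^ n))

degree : ∀ {q n} → Vector (Fin q) n → ℕ
degree e = sum (Vector.map toℕ e)

-- Counts monomials through their exponent tuples; a rational bound d is enough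
-- since the bound of interest, (q - 1) n / 3, is rational.
m : (q n : ℕ) → ℚ → ℕ
m q n d = length (filter (λ e → (+ degree e) / 1 ≤? d) (exponentTuples q n))

-- A field with finitely many elements has decidable equality and decidable
-- invertibility, so its apartness relation is necessarily the negation of _≈_:
-- finite Heyting fields are exactly finite fields in the classical sense.
module FieldVectors {c ℓ₁ ℓ₂} (F : HeytingField c ℓ₁ ℓ₂) where
  open HeytingField F

  fieldSetoid : Setoid c ℓ₁
  fieldSetoid = record { isEquivalence = isEquivalence }

  open VectorEquality fieldSetoid public using (_≋_; ≋-setoid)

  infixl 6 _+ᵥ_
  infixr 7 _·ᵥ_

  _+ᵥ_ : ∀ {n} → Vector Carrier n → Vector Carrier n → Vector Carrier n
  _+ᵥ_ = zipWith _+_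

  _·ᵥ_ : ∀ {n} → Carrier → Vector Carrier n → Vector Carrier n
  x ·ᵥ v = Vector.map (x *_) v

  0ᵥ : ∀ {n} → Vector Carrier n
  0ᵥ {n} = replicate n 0#

  OnlyTrivialSolutions : ∀ {n p} (α β γ : Carrier) → Pred (Vector Carrier n) p → Set (c ⊔ ℓ₁ ⊔ p)
  OnlyTrivialSolutions α β γ A =
    ∀ {a₁ a₂ a₃} → A a₁ → A a₂ → A a₃ →
    α ·ᵥ a₁ +ᵥ β ·ᵥ a₂ +ᵥ γ ·ᵥ a₃ ≋ 0ᵥ →
    a₁ ≋ a₂ × a₂ ≋ a₃

{-# OPTIONS --safe #-}
-- The slice rank method. Over all nonzero c, the product of 1 - w / c is a
-- polynomial of degree q - 1 in w that is 1 at w = 0 and 0 elsewhere. Multiplying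
-- its values at the n coordinates of αx + βy + γz gives a polynomial T(x, y, z)
-- of degree at most (q - 1)n, and by hypothesis T restricted to A³ is the
-- indicator of x = y = z. In each monomial of T one of the three blocks of
-- variables has degree at most (q - 1)n / 3; grouping by that block writes T as
-- a sum of 3M slices u(x) f(y, z), u(y) g(x, z), u(z) h(x, y), where M counts the
-- monomials u of low degree. Contract T in x with a vector orthogonal to all u
-- of support at least |A| - M: what remains is a diagonal matrix with at least
-- |A| - M nonzero entries and of rank at most 2M.
module Submission where

open import Defs
open import Algebra.Apartness.Bundles using (HeytingField)
import Algebra.Apartness.Properties.HeytingCommutativeRing
open import Algebra.Bundles using (CommutativeRing)
open import Data.Fin.Base
  using (Fin; zero; suc; toℕ; fromℕ<; finToFun; funToFin; punchIn; punchOut; _↑ˡ_; _↑ʳ_)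
open import Data.Fin.Properties
  using (_≟_; any?; ¬∀⟶∃¬; finToFun-funToFin; punchInᵢ≢i; punchIn-injective; punchIn-punchOut; toℕ-fromℕ<)
open import Data.Integer.Base using (+_; +≤+)
import Data.Integer.Base as ℤ
import Data.Integer.Properties as ℤ
open import Data.List.Base using (filter; lookup)
open import Data.List.Membership.Propositional using (_∈_)
open import Data.List.Membership.Propositional.Properties using (∈-filter⁺; ∈-map⁺; ∈-allFin)
open import Data.List.Relation.Unary.Any using (index)
open import Data.List.Relation.Unary.Any.Properties using (lookup-index)
open import Data.Nat.Base as ℕ using (ℕ; zero; suc; NonZero)
import Data.Nat.Properties as ℕ
open import Data.Nat.Solver using (module +-*-Solver)
open import Data.Product.Base using (∃; ∃₂; _×_; _,_; proj₁; proj₂)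
open import Data.Rational using (_/_; _≤?_)
import Data.Rational.Base as ℚ
open import Data.Rational.Properties using (toℚᵘ-cancel-≤; toℚᵘ-fromℚᵘ)
import Data.Rational.Unnormalised.Base as ℚᵘ
import Data.Rational.Unnormalised.Properties as ℚᵘ
open import Data.Sum.Base using (_⊎_; inj₁; inj₂)
open import Data.Vec.Functional using (Vector; _∷_; []; head; tail; _++_; insertAt; removeAt; updateAt)
open import Data.Vec.Functional.Properties
  using (insertAt-lookup; insertAt-punchIn; updateAt-updates; updateAt-minimal; lookup-++ˡ; lookup-++ʳ)
open import Function.Base using (_∘_; id; const)
open import Function.Bundles using (Inverse)
open import Function.Definitions using (Injective)
open import Level using (Level; _⊔_)
open import Relation.Binary.Bundles using (Setoid)
open import Relation.Binary.Definitions using (_Respects_; Decidable)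
open import Relation.Binary.PropositionalEquality as ≡ using (_≡_; _≢_; _≗_)
open import Relation.Nullary.Decidable using (yes; no; map′)
open import Relation.Nullary.Negation using (¬_; contradiction)
open import Relation.Unary using (Pred)
open import Algebra.Properties.CommutativeMonoid.Sum ℕ.+-0-commutativeMonoid using ()
  renaming (sum-cong-≗ to ℕ-sum-cong)

-- Finite sums and dot products over a commutative ring.

module RingSums {c ℓ} (R : CommutativeRing c ℓ) where
  open CommutativeRing R hiding (zero)
  open import Algebra.Properties.Semiring.Sum semiring public
  open import Relation.Binary.Reasoning.Setoid setoid

  sum-zero : ∀ {n} (t : Vector Carrier n) → (∀ i → t i ≈ 0#) → sum t ≈ 0#
  sum-zero {n} t t≈0 = trans (sum-cong-≋ t≈0) (sum-replicate-zero n)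

  sum-supported : ∀ {n} (i : Fin n) (t : Vector Carrier n) →
                  (∀ j → j ≢ i → t j ≈ 0#) → sum t ≈ t i
  sum-supported {suc n} i t t≈0 = begin
    sum t                       ≈⟨ sum-remove t ⟩
    t i + sum (removeAt t i)    ≈⟨ +-congˡ (sum-zero _ λ j → t≈0 (punchIn i j) (punchInᵢ≢i i j)) ⟩
    t i + 0#                    ≈⟨ +-identityʳ (t i) ⟩
    t i                         ∎

  infix 8 _∙_

  _∙_ : ∀ {n} → Vector Carrier n → Vector Carrier n → Carrier
  f ∙ g = sum λ i → f i * g i

  ∙-congˡ : ∀ {n} (f : Vector Carrier n) {g h : Vector Carrier n} →
            (∀ i → g i ≈ h i) → f ∙ g ≈ f ∙ h
  ∙-congˡ {n} f g≈h = sum-cong-≋ {n} λ i → *-congˡ (g≈h i)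

  ∙-comm : ∀ {n} (f g : Vector Carrier n) → f ∙ g ≈ g ∙ f
  ∙-comm {n} f g = sum-cong-≋ {n} λ i → *-comm (f i) (g i)

  ∙-distribˡ-+ : ∀ {n} (f g h : Vector Carrier n) → f ∙ (λ i → g i + h i) ≈ f ∙ g + f ∙ h
  ∙-distribˡ-+ {n} f g h = begin
    f ∙ (λ i → g i + h i)                 ≈⟨ sum-cong-≋ {n} (λ i → distribˡ (f i) (g i) (h i)) ⟩
    sum (λ i → f i * g i + f i * h i)     ≈⟨ ∑-distrib-+ {n} _ _ ⟩
    f ∙ g + f ∙ h                         ∎

  *-∙ : ∀ {n} x (f g : Vector Carrier n) → x * (f ∙ g) ≈ f ∙ (λ i → x * g i)
  *-∙ {n} x f g = trans (*-distribˡ-sum x λ i → f i * g i) (sum-cong-≋ {n} λ i → swap (f i) (g i))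
    where
    swap : ∀ y z → x * (y * z) ≈ y * (x * z)
    swap y z = trans (sym (*-assoc x y z)) (trans (*-congʳ (*-comm x y)) (*-assoc y x z))

  -- Associativity of the matrix product f A g, by exchanging the two sums.
  ∙-assoc : ∀ {m n} (f : Vector Carrier n) (A : Fin m → Vector Carrier n) (g : Vector Carrier m) →
            f ∙ (λ x → g ∙ λ i → A i x) ≈ g ∙ (λ i → f ∙ A i)
  ∙-assoc {m} {n} f A g = begin
    sum (λ x → f x * (g ∙ λ i → A i x))           ≈⟨ sum-cong-≋ {n} (λ x → *-∙ {m} (f x) g _) ⟩
    sum (λ x → sum (λ i → g i * (f x * A i x)))   ≈⟨ ∑-comm {n} {m} _ ⟩
    sum (λ i → sum (λ x → g i * (f x * A i x)))   ≈⟨ sum-cong-≋ {m} (λ i → *-distribˡ-sum {n} (g i) _) ⟨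
    sum (λ i → g i * (f ∙ A i))                   ∎

  -- This is how a contraction kills slices: what is orthogonal to each vector of a family is
  -- orthogonal to every linear combination of them.
  orthogonal : ∀ {m n} (f : Vector Carrier n) (A : Fin m → Vector Carrier n) (g : Vector Carrier m) →
               (∀ i → f ∙ A i ≈ 0#) → f ∙ (λ x → g ∙ λ i → A i x) ≈ 0#
  orthogonal f A g f⊥A = trans (∙-assoc f A g)
    (sum-zero _ λ i → trans (*-congˡ (f⊥A i)) (zeroʳ (g i)))

-- Linear algebra: orthogonal vectors of large support and the slice rank bound.

module SliceRank {c ℓ} (R : CommutativeRing c ℓ)
  (zero⊎unit : ∀ x → CommutativeRing._≈_ R x (CommutativeRing.0# R) ⊎
                     ∃ λ y → CommutativeRing._≈_ R (CommutativeRing._*_ R x y) (CommutativeRing.1# R))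
  (1≉0 : ¬ CommutativeRing._≈_ R (CommutativeRing.1# R) (CommutativeRing.0# R))
  where

  open CommutativeRing R hiding (zero)
  open RingSums R
  open import Algebra.Properties.Ring ring using (-‿distribˡ-*)
  open import Relation.Binary.Reasoning.Setoid setoid

  private
    variable
      k n r : ℕ

  x*y≉0 : ∀ {x y} → ¬ x ≈ 0# → ¬ y ≈ 0# → ¬ x * y ≈ 0#
  x*y≉0 {x} {y} x≉0 y≉0 xy≈0 with zero⊎unit y
  ... | inj₁ y≈0 = y≉0 y≈0
  ... | inj₂ (z , yz≈1) = x≉0 (begin
    x              ≈⟨ *-identityʳ x ⟨
    x * 1#         ≈⟨ *-congˡ yz≈1 ⟨
    x * (y * z)    ≈⟨ *-assoc x y z ⟨
    x * y * z      ≈⟨ *-congʳ xy≈0 ⟩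
    0# * z         ≈⟨ zeroˡ z ⟩
    0#             ∎)

  pivot : (f : Vector Carrier n) → (∀ i → f i ≈ 0#) ⊎ ∃₂ λ i y → f i * y ≈ 1#
  pivot {zero}  f = inj₁ λ ()
  pivot {suc n} f with zero⊎unit (f zero) | pivot (f ∘ suc)
  ... | inj₂ (y , eq) | _                  = inj₂ (zero , y , eq)
  ... | inj₁ _        | inj₂ (i , y , eq)  = inj₂ (suc i , y , eq)
  ... | inj₁ eq       | inj₁ eqs           = inj₁ λ { zero → eq ; (suc i) → eqs i }

  -- A lower bound on the support is given by an injection, which later serves to restrict vectors
  -- and matrices to these points.
  record LargeSupport (k : ℕ) {n : ℕ} (f : Vector Carrier n) : Set ℓ where
    constructor mkLargeSupport
    field
      point            : Fin k → Fin n
      point-injective  : Injective _≡_ _≡_ point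
      nonzero          : ∀ i → ¬ f (point i) ≈ 0#

  -- Gaussian elimination: each of the r constraints costs at most one point
  -- of the support.
  orthogonal-vector : (u : Fin r → Vector Carrier n) →
    ∃₂ λ f k → (∀ i → f ∙ u i ≈ 0#) × n ℕ.≤ k ℕ.+ r × LargeSupport k f
  orthogonal-vector {zero} {n} u =
    const 1# , n , (λ ()) , ℕ.m≤m+n n 0 , mkLargeSupport id id (const 1≉0)
  orthogonal-vector {suc r} {n} u with pivot (u zero)
  orthogonal-vector {suc r} {n} u | inj₁ u₀≈0 with orthogonal-vector (u ∘ suc)
  ... | f , k , f⊥u , n≤k+r , supp =
    f , k , (λ { zero → sum-zero _ λ x → trans (*-congˡ (u₀≈0 x)) (zeroʳ (f x)) ; (suc i) → f⊥u i }) ,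
    ℕ.≤-trans n≤k+r (ℕ.+-monoʳ-≤ k (ℕ.n≤1+n r)) , supp
  orthogonal-vector {suc r} {suc n} u | inj₂ (p , v , u₀v≈1) =
    extend (orthogonal-vector reduced)
    where
    u₀ : Vector Carrier n
    u₀ = removeAt (u zero) p

    coeff : Fin r → Carrier
    coeff i = - (u (suc i) p * v)

    -- The multiple of `u zero` is chosen to cancel the entry at the pivot `p`: since v is the
    -- inverse of `u zero p`, the combination vanishes there and only the other entries remain.
    reduced : Fin r → Vector Carrier n
    reduced i x = removeAt (u (suc i)) p x + coeff i * u₀ x

    extend : (∃₂ λ f k → (∀ i → f ∙ reduced i ≈ 0#) × n ℕ.≤ k ℕ.+ r × LargeSupport k f) →
             ∃₂ λ f k → (∀ i → f ∙ u i ≈ 0#) × suc n ℕ.≤ k ℕ.+ suc r × LargeSupport k f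
    extend (f , k , f⊥ , n≤k+r , mkLargeSupport s s-inj fs≉0) =
      g , k , g⊥u , ≡.subst (suc n ℕ.≤_) (≡.sym (ℕ.+-suc k r)) (ℕ.s≤s n≤k+r) ,
      -- The new entry at `p` may be zero, so only the old points count; this is the one point lost
      -- to the constraint.
      mkLargeSupport (punchIn p ∘ s) (s-inj ∘ punchIn-injective p _ _)
        (λ i → fs≉0 i ∘ trans (reflexive (≡.sym (insertAt-punchIn f p gₚ (s i)))))
      where
      w gₚ : Carrier
      w = f ∙ u₀
      -- The value forced by orthogonality to `u zero`: it solves `gₚ * u zero p + w ≈ 0#`.
      gₚ = - (v * w)

      g : Vector Carrier (suc n)
      g = insertAt f p gₚ

      g∙ : ∀ t → g ∙ t ≈ gₚ * t p + f ∙ removeAt t p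
      g∙ t = begin
        g ∙ t
          ≈⟨ sum-remove {i = p} (λ x → g x * t x) ⟩
        g p * t p + sum (λ x → g (punchIn p x) * t (punchIn p x))
          ≈⟨ +-cong (*-congʳ (reflexive (insertAt-lookup f p gₚ)))
                    (sum-cong-≋ {n} λ x → *-congʳ (reflexive (insertAt-punchIn f p gₚ x))) ⟩
        gₚ * t p + f ∙ removeAt t p
          ∎

      gₚ*a : ∀ a → gₚ * a ≈ - (a * v) * w
      gₚ*a a = begin
        - (v * w) * a    ≈⟨ -‿distribˡ-* (v * w) a ⟨
        - (v * w * a)    ≈⟨ -‿cong (trans (*-comm (v * w) a) (sym (*-assoc a v w))) ⟩
        - (a * v * w)    ≈⟨ -‿distribˡ-* (a * v) w ⟩
        - (a * v) * w    ∎

      g⊥u : ∀ i → g ∙ u i ≈ 0#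
      g⊥u zero = begin
        g ∙ u zero                  ≈⟨ g∙ (u zero) ⟩
        gₚ * u zero p + w           ≈⟨ +-congʳ (gₚ*a (u zero p)) ⟩
        - (u zero p * v) * w + w    ≈⟨ +-congʳ (*-congʳ (-‿cong u₀v≈1)) ⟩
        - 1# * w + w                ≈⟨ +-congʳ (-‿distribˡ-* 1# w) ⟨
        - (1# * w) + w              ≈⟨ +-congʳ (-‿cong (*-identityˡ w)) ⟩
        - w + w                     ≈⟨ -‿inverseˡ w ⟩
        0#                          ∎
      g⊥u (suc i) = begin
        g ∙ u (suc i)
          ≈⟨ g∙ (u (suc i)) ⟩
        gₚ * u (suc i) p + f ∙ removeAt (u (suc i)) p
          ≈⟨ +-comm _ _ ⟩
        f ∙ removeAt (u (suc i)) p + gₚ * u (suc i) p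
          ≈⟨ +-congˡ (gₚ*a (u (suc i) p)) ⟩
        f ∙ removeAt (u (suc i)) p + coeff i * w
          ≈⟨ +-congˡ (*-∙ (coeff i) f u₀) ⟩
        f ∙ removeAt (u (suc i)) p + f ∙ (λ x → coeff i * u₀ x)
          ≈⟨ ∙-distribˡ-+ f _ _ ⟨
        f ∙ reduced i
          ≈⟨ f⊥ i ⟩
        0#
          ∎

  -- The rank comparison is made by duality. After contraction with `a`, restricted in y to the
  -- support of `a`, each column is a combination of 2M fixed vectors. A vector `b` orthogonal to
  -- these annihilates every column, yet a nonzero entry of `b` would meet a nonzero diagonal entry.
  -- So `b` has empty support, which bounds the support of `a` by 2M.
  slice-rank : ∀ {M N} (u : Fin M → Vector Carrier N) (f g h : Fin M → Fin N → Fin N → Carrier) →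
    let T = λ x y z → (λ i → u i x) ∙ (λ i → f i y z) +
                      ((λ i → u i y) ∙ (λ i → g i x z) + (λ i → u i z) ∙ (λ i → h i x y))
    in
    (∀ x → ¬ T x x x ≈ 0#) →
    (∀ {x y z} → ¬ (x ≡ y × y ≡ z) → T x y z ≈ 0#) →
    N ℕ.≤ M ℕ.+ (M ℕ.+ M)
  slice-rank {M} {N} u f g h diag off-diag with orthogonal-vector u
  ... | a , k , a⊥u , N≤k+M , mkLargeSupport s s-inj as≉0
      -- The 2M constraints on `b`, as vectors in y: the `u i` on the support of `a`, and the `h i`
      -- contracted with `a`.
      with orthogonal-vector ((λ i → u i ∘ s) ++ (λ i y → a ∙ λ x → h i x (s y)))
  ... | b , suc _ , b⊥ , _ , mkLargeSupport t _ bt≉0 =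
    contradiction (trans (sym contraction-diag) contraction-zero)
      (x*y≉0 (bt≉0 zero) (x*y≉0 (as≉0 (t zero)) (diag (s (t zero)))))
    where
    T = λ x y z → (λ i → u i x) ∙ (λ i → f i y z) +
                  ((λ i → u i y) ∙ (λ i → g i x z) + (λ i → u i z) ∙ (λ i → h i x y))

    -- A point where `b` is nonzero; the column tested is the one whose diagonal entry lies in that
    -- row.
    y₀ = t zero
    z = s y₀

    b⊥u : ∀ i → b ∙ (u i ∘ s) ≈ 0#
    b⊥u i = ≡.subst (λ v → b ∙ v ≈ 0#) (lookup-++ˡ _ _ i) (b⊥ (i ↑ˡ M))

    b⊥h : ∀ i → b ∙ (λ y → a ∙ λ x → h i x (s y)) ≈ 0#
    b⊥h i = ≡.subst (λ v → b ∙ v ≈ 0#) (lookup-++ʳ (λ j → u j ∘ s) _ i) (b⊥ (M ↑ʳ i))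

    -- Both sums collapse to one term: injectivity of `s` leaves only `y₀` in the outer sum, and
    -- then only `z` survives in the inner one.
    contraction-diag : b ∙ (λ y → a ∙ λ x → T x (s y) z) ≈ b y₀ * (a z * T z z z)
    contraction-diag = trans
      (sum-supported y₀ _ λ y y≢y₀ → trans (*-congˡ (sum-zero _ λ x →
        trans (*-congˡ (off-diag λ (_ , sy≡z) → y≢y₀ (s-inj sy≡z))) (zeroʳ (a x)))) (zeroʳ (b y)))
      (*-congˡ (sum-supported z _ λ x x≢z →
        trans (*-congˡ (off-diag λ (x≡z , _) → x≢z x≡z)) (zeroʳ (a x))))

    -- The slices with x alone disappear because `a` is orthogonal to all `u i`; in the others `a`
    -- is absorbed into `g` and `h`.
    contraction-x : ∀ y → a ∙ (λ x → T x y z) ≈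
      (λ i → u i y) ∙ (λ i → a ∙ λ x → g i x z) + (λ i → u i z) ∙ (λ i → a ∙ λ x → h i x y)
    contraction-x y = begin
      a ∙ (λ x → T x y z)
        ≈⟨ ∙-distribˡ-+ a _ _ ⟩
      a ∙ (λ x → (λ i → u i x) ∙ (λ i → f i y z)) + _
        ≈⟨ +-congʳ (∙-congˡ a (λ x → ∙-comm {M} _ _)) ⟩
      a ∙ (λ x → (λ i → f i y z) ∙ (λ i → u i x)) + _
        ≈⟨ +-cong (orthogonal a u _ a⊥u) (∙-distribˡ-+ a _ _) ⟩
      0# + (_ + _)
        ≈⟨ +-identityˡ _ ⟩
      a ∙ (λ x → (λ i → u i y) ∙ (λ i → g i x z)) + a ∙ (λ x → (λ i → u i z) ∙ (λ i → h i x y))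
        ≈⟨ +-cong (∙-assoc a (λ i x → g i x z) _) (∙-assoc a (λ i x → h i x y) _) ⟩
      (λ i → u i y) ∙ (λ i → a ∙ λ x → g i x z) + (λ i → u i z) ∙ (λ i → a ∙ λ x → h i x y)
        ∎

    contraction-zero : b ∙ (λ y → a ∙ λ x → T x (s y) z) ≈ 0#
    contraction-zero = begin
      b ∙ (λ y → a ∙ λ x → T x (s y) z)
        ≈⟨ ∙-congˡ b (λ y → trans (contraction-x (s y)) (+-congʳ (∙-comm {M} _ _))) ⟩
      b ∙ (λ y → (λ i → a ∙ λ x → g i x z) ∙ (λ i → u i (s y)) + _)
        ≈⟨ ∙-distribˡ-+ b _ _ ⟩
      _ + _
        ≈⟨ +-cong (orthogonal b _ _ b⊥u) (orthogonal b (λ i y → a ∙ λ x → h i x (s y)) _ b⊥h) ⟩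
      0# + 0#
        ≈⟨ +-identityˡ 0# ⟩
      0#
        ∎
  -- With an empty support the count for `b` reads k ≤ 0 + 2M, to be combined with N ≤ k + M.
  ... | b , zero , _ , k≤M+M , _ =
    ℕ.≤-trans N≤k+M (≡.subst (k ℕ.+ M ℕ.≤_) (ℕ.+-comm (M ℕ.+ M) M) (ℕ.+-monoˡ-≤ M k≤M+M))

-- Averaging: if all three failed, adding the strict inequalities would give 3D < 3(a + b + c). The
-- factor 3 keeps the comparison within the natural numbers.
some-third : ∀ {a b c D} → a ℕ.+ b ℕ.+ c ℕ.≤ D →
             3 ℕ.* a ℕ.≤ D ⊎ 3 ℕ.* b ℕ.≤ D ⊎ 3 ℕ.* c ℕ.≤ D
some-third {a} {b} {c} {D} a+b+c≤D with 3 ℕ.* a ℕ.≤? D | 3 ℕ.* b ℕ.≤? D | 3 ℕ.* c ℕ.≤? D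
... | yes 3a≤D | _        | _        = inj₁ 3a≤D
... | no _     | yes 3b≤D | _        = inj₂ (inj₁ 3b≤D)
... | no _     | no _     | yes 3c≤D = inj₂ (inj₂ 3c≤D)
... | no 3a≰D  | no 3b≰D  | no 3c≰D  = contradiction
  (begin-strict
    3 ℕ.* (a ℕ.+ b ℕ.+ c)                   ≤⟨ ℕ.*-monoʳ-≤ 3 a+b+c≤D ⟩
    3 ℕ.* D                                 ≡⟨ solve 1 (λ d → con 3 :* d := d :+ d :+ d) ≡.refl D ⟩
    D ℕ.+ D ℕ.+ D                           <⟨ ℕ.+-mono-< (ℕ.+-mono-< (ℕ.≰⇒> 3a≰D) (ℕ.≰⇒> 3b≰D)) (ℕ.≰⇒> 3c≰D) ⟩
    3 ℕ.* a ℕ.+ 3 ℕ.* b ℕ.+ 3 ℕ.* c         ≡⟨ solve 3 (λ a b c → con 3 :* a :+ con 3 :* b :+ con 3 :* c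
                                                                  := con 3 :* (a :+ b :+ c)) ≡.refl a b c ⟩
    3 ℕ.* (a ℕ.+ b ℕ.+ c)                   ∎)
  (ℕ.<-irrefl ≡.refl)
  where
  open ℕ.≤-Reasoning
  open +-*-Solver

-- Polynomial functions in three blocks of variables.

module Polynomials {c ℓ} (R : CommutativeRing c ℓ) where
  open CommutativeRing R hiding (zero)
  open RingSums R
  open import Algebra.Properties.CommutativeMonoid.Sum *-commutativeMonoid public using ()
    renaming (sum to product; sum-remove to product-remove; sum-cong-≋ to product-cong;
              sum-replicate-zero to product-replicate-one)
  open import Algebra.Properties.Semiring.Exp semiring
  open import Algebra.Solver.CommutativeMonoid *-commutativeMonoid using (solve; _⊜_)
    renaming (_⊕_ to _⊗_; id to one)
  open import Relation.Binary.Reasoning.Setoid setoid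

  product-zero : ∀ {n} (i : Fin n) (t : Vector Carrier n) → t i ≈ 0# → product t ≈ 0#
  product-zero {suc n} i t tᵢ≈0 = begin
    product t                          ≈⟨ product-remove t ⟩
    t i * product (removeAt t i)       ≈⟨ *-congʳ tᵢ≈0 ⟩
    0# * product (removeAt t i)        ≈⟨ zeroˡ _ ⟩
    0#                                 ∎

  product-one : ∀ {n} (t : Vector Carrier n) → (∀ i → t i ≈ 1#) → product t ≈ 1#
  product-one {n} t t≈1 = trans (product-cong t≈1) (product-replicate-one n)

  monomial : ∀ {k n} → Vector (Fin k) n → Vector Carrier n → Carrier
  monomial e x = product λ i → x i ^ toℕ (e i)

  private
    variable
      p p′ p″ : Level
      X Y Z : Set c

  -- Polynomials are treated as functions up to pointwise equality. Scalars are carried by the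
  -- generators, whose coefficients are arbitrary in the uses below, so closure under sums gives
  -- linear combinations.
  data Spanned {X : Set c} (S : Pred (X → Carrier) p) : Pred (X → Carrier) (c ⊔ ℓ ⊔ p) where
    gen   : ∀ {f} → S f → Spanned S f
    _⊕_   : ∀ {f g} → Spanned S f → Spanned S g → Spanned S (λ x → f x + g x)
    resp  : ∀ {f g} → (∀ x → f x ≈ g x) → Spanned S f → Spanned S g

  -- Expansion by distributivity. The projections let the factors share their variables (both `id`)
  -- or depend on separate coordinates (`head` and `tail`).
  Spanned-* : {S : Pred (X → Carrier) p} {T : Pred (Y → Carrier) p′} {U : Pred (Z → Carrier) p″}
    (π : Z → X) (ρ : Z → Y) →
    (∀ {f g} → S f → T g → U (λ z → f (π z) * g (ρ z))) →
    ∀ {f g} → Spanned S f → Spanned T g → Spanned U (λ z → f (π z) * g (ρ z))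
  Spanned-* π ρ mul (gen s)               (gen t)               = gen (mul s t)
  Spanned-* π ρ mul (resp eq s)           t                     =
    resp (λ z → *-congʳ (eq (π z))) (Spanned-* π ρ mul s t)
  Spanned-* π ρ mul (_⊕_ {f} {f′} s s′)   t                     =
    resp (λ z → sym (distribʳ _ (f (π z)) (f′ (π z))))
      (Spanned-* π ρ mul s t ⊕ Spanned-* π ρ mul s′ t)
  Spanned-* π ρ mul {f} (gen s)           (resp eq t)           =
    resp (λ z → *-congˡ {f (π z)} (eq (ρ z))) (Spanned-* π ρ mul {f} (gen s) t)
  Spanned-* π ρ mul {f} (gen s)           (_⊕_ {g} {g′} t t′)   =
    resp (λ z → sym (distribˡ (f (π z)) (g (ρ z)) (g′ (ρ z))))
      (Spanned-* π ρ mul {f} (gen s) t ⊕ Spanned-* π ρ mul {f} (gen s) t′)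

  Triple : Set c → Set c
  Triple X = X × X × X

  mapTriple : (X → Y) → Triple X → Triple Y
  mapTriple f (x , y , z) = f x , f y , f z

  -- The exponents E are abstract so that a single coordinate (E = ℕ) and the whole
  -- space share the product lemma.
  record Monomial {E : Set} {X : Set c} (pow : E → X → Carrier) (deg : E → ℕ) (D : ℕ)
                  (f : Triple X → Carrier) : Set (c ⊔ ℓ) where
    constructor mkMonomial
    field
      coefficient  : Carrier
      a b e        : E
      bound        : deg a ℕ.+ deg b ℕ.+ deg e ℕ.≤ D
      equation     : ∀ x y z → f (x , y , z) ≈ coefficient * (pow a x * pow b y * pow e z)

  -- Here `join` stands for adding exponents of one variable or for prepending the exponent of a new
  -- coordinate. Its premise `deg a ℕ.≤ D`, available because each block has at most the total
  -- degree, lets the prepended exponent fit into a bounded `Fin`.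
  Monomial-* :
    {E E′ E″ : Set} {pow : E → X → Carrier} {pow′ : E′ → Y → Carrier} {pow″ : E″ → Z → Carrier}
    {deg : E → ℕ} {deg′ : E′ → ℕ} {deg″ : E″ → ℕ} {D D′ : ℕ} (π : Z → X) (ρ : Z → Y) →
    (∀ a a′ → deg a ℕ.≤ D → ∃ λ a″ → deg″ a″ ≡ deg a ℕ.+ deg′ a′ ×
                                     (∀ x → pow″ a″ x ≈ pow a (π x) * pow′ a′ (ρ x))) →
    ∀ {f g} → Monomial pow deg D f → Monomial pow′ deg′ D′ g →
    Monomial pow″ deg″ (D ℕ.+ D′) (λ t → f (mapTriple π t) * g (mapTriple ρ t))
  Monomial-* {deg = deg} {deg′} {deg″} {D} {D′} π ρ join
    (mkMonomial k a b e a+b+e≤D f≈) (mkMonomial k′ a′ b′ e′ a′+b′+e′≤D′ g≈)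
    with join a a′ (ℕ.m+n≤o⇒m≤o (deg a) (ℕ.m+n≤o⇒m≤o (deg a ℕ.+ deg b) a+b+e≤D))
       | join b b′ (ℕ.m+n≤o⇒n≤o (deg a) (ℕ.m+n≤o⇒m≤o (deg a ℕ.+ deg b) a+b+e≤D))
       | join e e′ (ℕ.m+n≤o⇒n≤o (deg a ℕ.+ deg b) a+b+e≤D)
  ... | A , degA , powA | B , degB , powB | C , degC , powC =
    mkMonomial (k * k′) A B C bound λ x y z → trans (*-cong (f≈ _ _ _) (g≈ _ _ _))
      (trans (rearrange k k′ _ _ _ _ _ _)
             (*-congˡ (sym (*-cong (*-cong (powA x) (powB y)) (powC z)))))
    where
    rearrange : ∀ k k′ a a′ b b′ e e′ →
      k * (a * b * e) * (k′ * (a′ * b′ * e′)) ≈ k * k′ * (a * a′ * (b * b′) * (e * e′))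
    rearrange = solve 8 (λ k k′ a a′ b b′ e e′ →
      (k ⊗ ((a ⊗ b) ⊗ e)) ⊗ (k′ ⊗ ((a′ ⊗ b′) ⊗ e′))
      ⊜ (k ⊗ k′) ⊗ (((a ⊗ a′) ⊗ (b ⊗ b′)) ⊗ (e ⊗ e′))) refl

    bound : deg″ A ℕ.+ deg″ B ℕ.+ deg″ C ℕ.≤ D ℕ.+ D′
    bound = ≡.subst (ℕ._≤ D ℕ.+ D′) (≡.sym (≡.trans
      (≡.cong₂ ℕ._+_ (≡.cong₂ ℕ._+_ degA degB) degC)
      (ℕ-rearrange (deg a) (deg′ a′) (deg b) (deg′ b′) (deg e) (deg′ e′))))
      (ℕ.+-mono-≤ a+b+e≤D a′+b′+e′≤D′)
      where
      open +-*-Solver using (_:+_; _:=_) renaming (solve to ℕ-solve)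
      ℕ-rearrange : ∀ a a′ b b′ e e′ →
        (a ℕ.+ a′) ℕ.+ (b ℕ.+ b′) ℕ.+ (e ℕ.+ e′) ≡ (a ℕ.+ b ℕ.+ e) ℕ.+ (a′ ℕ.+ b′ ℕ.+ e′)
      ℕ-rearrange = ℕ-solve 6 (λ a a′ b b′ e e′ →
        (a :+ a′) :+ (b :+ b′) :+ (e :+ e′) := (a :+ b :+ e) :+ (a′ :+ b′ :+ e′)) ≡.refl

  Monomial₁ : ℕ → Pred (Triple Carrier → Carrier) (c ⊔ ℓ)
  Monomial₁ = Monomial (λ e x → x ^ e) id

  Monomialₙ : (k n D : ℕ) → Pred (Triple (Vector Carrier n) → Carrier) (c ⊔ ℓ)
  Monomialₙ k n = Monomial monomial (degree {k} {n})

  linear-factor-spanned : ∀ α β γ v →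
    Spanned (Monomial₁ 1) (λ (x , y , z) → 1# + v * (α * x + β * y + γ * z))
  linear-factor-spanned α β γ v =
    resp (λ (x , y , z) → +-congˡ (sym (trans (distribˡ v _ _) (+-congʳ (distribˡ v _ _)))))
      (gen (mkMonomial 1# 0 0 0 ℕ.z≤n λ x y z → solve 0 (one ⊜ one ⊗ ((one ⊗ one) ⊗ one)) refl)
       ⊕ ((gen (mkMonomial (v * α) 1 0 0 ℕ.≤-refl λ x y z →
             solve 3 (λ v α x → v ⊗ (α ⊗ x) ⊜ (v ⊗ α) ⊗ (((x ⊗ one) ⊗ one) ⊗ one)) refl v α x)
       ⊕ gen (mkMonomial (v * β) 0 1 0 ℕ.≤-refl λ x y z →
             solve 3 (λ v α x → v ⊗ (α ⊗ x) ⊜ (v ⊗ α) ⊗ ((one ⊗ (x ⊗ one)) ⊗ one)) refl v β y))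
       ⊕ gen (mkMonomial (v * γ) 0 0 1 ℕ.≤-refl λ x y z →
             solve 3 (λ v α x → v ⊗ (α ⊗ x) ⊜ (v ⊗ α) ⊗ ((one ⊗ one) ⊗ (x ⊗ one))) refl v γ z)))

  product-spanned₁ : ∀ k (f : Fin k → Triple Carrier → Carrier) →
    (∀ j → Spanned (Monomial₁ 1) (f j)) → Spanned (Monomial₁ k) (λ t → product λ j → f j t)
  product-spanned₁ zero    f f∈ =
    gen (mkMonomial 1# 0 0 0 ℕ.z≤n λ x y z → solve 0 (one ⊜ one ⊗ ((one ⊗ one) ⊗ one)) refl)
  product-spanned₁ (suc k) f f∈ =
    Spanned-* id id (Monomial-* id id λ a a′ _ → a ℕ.+ a′ , ≡.refl , λ x → ^-homo-* x a a′)
      (f∈ zero) (product-spanned₁ k (f ∘ suc) (f∈ ∘ suc))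

  -- The i-th factor involves only coordinate i and has total degree at most k, so each exponent of
  -- that coordinate is at most k and lies in `Fin (suc k)`, while the total degree is at most nk.
  product-spannedₙ : ∀ {k} n (f : Fin n → Triple Carrier → Carrier) →
    (∀ i → Spanned (Monomial₁ k) (f i)) →
    Spanned (Monomialₙ (suc k) n (n ℕ.* k)) (λ t → product λ i → f i (mapTriple (λ x → x i) t))
  product-spannedₙ zero f f∈ =
    gen (mkMonomial 1# [] [] [] ℕ.z≤n λ x y z → solve 0 (one ⊜ one ⊗ ((one ⊗ one) ⊗ one)) refl)
  product-spannedₙ {k} (suc n) f f∈ =
    Spanned-* (mapTriple head) (mapTriple tail) (Monomial-* head tail join)
      (f∈ zero) (product-spannedₙ n (f ∘ suc) (f∈ ∘ suc))
    where
    join : ∀ a (a′ : Vector (Fin (suc k)) n) → a ℕ.≤ k →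
           ∃ λ (a″ : Vector (Fin (suc k)) (suc n)) → degree a″ ≡ a ℕ.+ degree a′ ×
                  (∀ x → monomial a″ x ≈ head x ^ a * monomial a′ (tail x))
    join a a′ a≤k = fromℕ< (ℕ.s≤s a≤k) ∷ a′ ,
      ≡.cong (ℕ._+ degree a′) (toℕ-fromℕ< (ℕ.s≤s a≤k)) ,
      λ x → *-congʳ (^-congʳ (head x) (toℕ-fromℕ< (ℕ.s≤s a≤k)))

  -- From monomials to slices.

  record Sliced {M : ℕ} {X : Set c} (u : Fin M → X → Carrier)
                (T : Triple X → Carrier) : Set (c ⊔ ℓ) where
    constructor mkSliced
    field
      f g h     : Fin M → X → X → Carrier
      equation  : ∀ x y z → T (x , y , z) ≈ (λ i → u i x) ∙ (λ i → f i y z) +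
                    ((λ i → u i y) ∙ (λ i → g i x z) + (λ i → u i z) ∙ (λ i → h i x y))

  -- The functions `u` are fixed in advance, so adding two decompositions only adds cofactors and
  -- the number of slices stays 3M.
  Sliced-+ : ∀ {M} {u : Fin M → X → Carrier} {S T} → Sliced u S → Sliced u T → Sliced u (λ t → S t + T t)
  Sliced-+ {u = u} {S} {T} (mkSliced f g h S≈) (mkSliced f′ g′ h′ T≈) =
    mkSliced (add f f′) (add g g′) (add h h′) λ x y z → begin
      S (x , y , z) + T (x , y , z)
        ≈⟨ +-cong (S≈ x y z) (T≈ x y z) ⟩
      _ + _
        ≈⟨ interchange _ _ _ _ ⟩
      _ + (_ + _)
        ≈⟨ +-congˡ (interchange _ _ _ _) ⟩
      _ + (_ + _)
        ≈⟨ +-cong (∙-distribˡ-+ (λ i → u i x) _ _)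
             (+-cong (∙-distribˡ-+ (λ i → u i y) _ _) (∙-distribˡ-+ (λ i → u i z) _ _)) ⟨
      _ + (_ + _)
        ∎
    where
    open import Algebra.Properties.CommutativeSemigroup +-commutativeSemigroup using (interchange)

    add : (f f′ : Fin _ → X → X → Carrier) → Fin _ → X → X → Carrier
    add f f′ i x y = f i x y + f′ i x y

  module _ {M : ℕ} (j : Fin M) (v : Carrier) where

    -- The j-th standard basis vector scaled by v.
    single : Vector Carrier M
    single = updateAt (const 0#) j (const v)

    ∙-single : ∀ (t : Vector Carrier M) → t ∙ single ≈ t j * v
    ∙-single t = trans
      (sum-supported j _ λ i i≢j → trans (*-congˡ (reflexive (updateAt-minimal i j _ i≢j))) (zeroʳ (t i)))
      (*-congˡ (reflexive (updateAt-updates j _)))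

  ∙-zero : ∀ {M} (t : Vector Carrier M) → t ∙ const 0# ≈ 0#
  ∙-zero t = sum-zero _ λ i → zeroʳ (t i)

  module _ {E : Set} {pow : E → X → Carrier} {deg : E → ℕ} {D M : ℕ} (u : Fin M → X → Carrier)
    (low : ∀ e → 3 ℕ.* deg e ℕ.≤ D → ∃ λ j → ∀ x → pow e x ≈ u j x)
    where

    -- By `some-third` one block has degree at most D / 3, hence is some `u j`; the coefficient and
    -- the other two blocks form the cofactor at index j, and all other cofactors are zero.
    Monomial⇒Sliced : ∀ {T} → Monomial pow deg D T → Sliced u T
    Monomial⇒Sliced {T} (mkMonomial k a b e a+b+e≤D T≈) with some-third {deg a} {deg b} {deg e} a+b+e≤D
    ... | inj₁ 3a≤D with low a 3a≤D
    ...   | j , eq = mkSliced (λ i y z → single j (k * (pow b y * pow e z)) i) (λ _ _ _ → 0#) (λ _ _ _ → 0#)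
      λ x y z → begin
      T (x , y , z)
        ≈⟨ T≈ x y z ⟩
      k * (pow a x * pow b y * pow e z)
        ≈⟨ *-congˡ (*-congʳ (*-congʳ (eq x))) ⟩
      k * (u j x * pow b y * pow e z)
        ≈⟨ solve 4 (λ k a b e → k ⊗ ((a ⊗ b) ⊗ e) ⊜ a ⊗ (k ⊗ (b ⊗ e))) refl k (u j x) (pow b y) (pow e z) ⟩
      u j x * (k * (pow b y * pow e z))
        ≈⟨ ∙-single j _ (λ i → u i x) ⟨
      (λ i → u i x) ∙ single j (k * (pow b y * pow e z))
        ≈⟨ trans (+-congˡ (+-identityˡ 0#)) (+-identityʳ _) ⟨
      (λ i → u i x) ∙ single j (k * (pow b y * pow e z)) + (0# + 0#)
        ≈⟨ +-congˡ (+-cong (∙-zero (λ i → u i y)) (∙-zero (λ i → u i z))) ⟨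
      _ + (_ + _)
        ∎
    Monomial⇒Sliced {T} (mkMonomial k a b e a+b+e≤D T≈) | inj₂ (inj₁ 3b≤D) with low b 3b≤D
    ...   | j , eq = mkSliced (λ _ _ _ → 0#) (λ i x z → single j (k * (pow a x * pow e z)) i) (λ _ _ _ → 0#)
      λ x y z → begin
      T (x , y , z)
        ≈⟨ T≈ x y z ⟩
      k * (pow a x * pow b y * pow e z)
        ≈⟨ *-congˡ (*-congʳ (*-congˡ (eq y))) ⟩
      k * (pow a x * u j y * pow e z)
        ≈⟨ solve 4 (λ k a b e → k ⊗ ((a ⊗ b) ⊗ e) ⊜ b ⊗ (k ⊗ (a ⊗ e))) refl k (pow a x) (u j y) (pow e z) ⟩
      u j y * (k * (pow a x * pow e z))
        ≈⟨ ∙-single j _ (λ i → u i y) ⟨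
      (λ i → u i y) ∙ single j (k * (pow a x * pow e z))
        ≈⟨ trans (+-identityˡ _) (+-identityʳ _) ⟨
      0# + ((λ i → u i y) ∙ single j (k * (pow a x * pow e z)) + 0#)
        ≈⟨ +-cong (∙-zero (λ i → u i x)) (+-congˡ (∙-zero (λ i → u i z))) ⟨
      _ + (_ + _)
        ∎
    Monomial⇒Sliced {T} (mkMonomial k a b e a+b+e≤D T≈) | inj₂ (inj₂ 3e≤D) with low e 3e≤D
    ...   | j , eq = mkSliced (λ _ _ _ → 0#) (λ _ _ _ → 0#) (λ i x y → single j (k * (pow a x * pow b y)) i)
      λ x y z → begin
      T (x , y , z)
        ≈⟨ T≈ x y z ⟩
      k * (pow a x * pow b y * pow e z)
        ≈⟨ *-congˡ (*-congˡ (eq z)) ⟩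
      k * (pow a x * pow b y * u j z)
        ≈⟨ solve 4 (λ k a b e → k ⊗ ((a ⊗ b) ⊗ e) ⊜ e ⊗ (k ⊗ (a ⊗ b))) refl k (pow a x) (pow b y) (u j z) ⟩
      u j z * (k * (pow a x * pow b y))
        ≈⟨ ∙-single j _ (λ i → u i z) ⟨
      (λ i → u i z) ∙ single j (k * (pow a x * pow b y))
        ≈⟨ trans (+-identityˡ _) (+-identityˡ _) ⟨
      0# + (0# + (λ i → u i z) ∙ single j (k * (pow a x * pow b y)))
        ≈⟨ +-cong (∙-zero (λ i → u i x)) (+-congʳ (∙-zero (λ i → u i y))) ⟨
      _ + (_ + _)
        ∎

    Spanned⇒Sliced : ∀ {T} → Spanned (Monomial pow deg D) T → Sliced u T
    Spanned⇒Sliced (gen s)       = Monomial⇒Sliced s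
    Spanned⇒Sliced (s ⊕ t)       = Sliced-+ (Spanned⇒Sliced s) (Spanned⇒Sliced t)
    Spanned⇒Sliced (resp eq s) with Spanned⇒Sliced s
    ... | mkSliced f g h S≈ = mkSliced f g h λ x y z → trans (sym (eq (x , y , z))) (S≈ x y z)

-- Low-degree exponent tuples and the rational degree bound.

3*d≤D⇒d/1≤D/3 : ∀ d D → 3 ℕ.* d ℕ.≤ D → (+ d) / 1 ℚ.≤ (+ D) / 3
3*d≤D⇒d/1≤D/3 d D 3d≤D = toℚᵘ-cancel-≤ (begin
  -- In unnormalised rationals no common factor has been cancelled, and the comparison is the cross
  -- multiplication d · 3 ≤ D · 1.
  ℚ.toℚᵘ ((+ d) / 1)      ≃⟨ toℚᵘ-fromℚᵘ ((+ d) ℚᵘ./ 1) ⟩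
  (+ d) ℚᵘ./ 1            ≤⟨ ℚᵘ.*≤* (≡.subst₂ ℤ._≤_ (ℤ.pos-* d 3) (≡.sym (ℤ.*-identityʳ (+ D)))
                                      (+≤+ (≡.subst (ℕ._≤ D) (ℕ.*-comm 3 d) 3d≤D))) ⟩
  (+ D) ℚᵘ./ 3            ≃⟨ toℚᵘ-fromℚᵘ ((+ D) ℚᵘ./ 3) ⟨
  ℚ.toℚᵘ ((+ D) / 3)      ∎)
  where open ℚᵘ.≤-Reasoning

-- Tuples are functions, so `e` is found in the list only up to pointwise equality: the listed tuple
-- is the copy `finToFun (funToFin e)`, which has the same degree.
low-degree-index : ∀ {q n} D (e : Vector (Fin q) n) → 3 ℕ.* degree e ℕ.≤ D →
  ∃ λ j → lookup (filter (λ e → (+ degree e) / 1 ≤? (+ D) / 3) (exponentTuples q n)) j ≗ e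
low-degree-index {q} {n} D e 3e≤D = index e′∈low , λ i →
  ≡.trans (≡.cong (λ f → f i) (≡.sym (lookup-index e′∈low))) (finToFun-funToFin e i)
  where
  e′ : Vector (Fin q) n
  e′ = finToFun (funToFin e)

  degree-e′ : degree e′ ≡ degree e
  degree-e′ = ℕ-sum-cong (≡.cong toℕ ∘ finToFun-funToFin e)

  e′∈low : e′ ∈ filter (λ e → (+ degree e) / 1 ≤? (+ D) / 3) (exponentTuples q n)
  e′∈low = ∈-filter⁺ _ (∈-map⁺ finToFun (∈-allFin (funToFin e)))
    (3*d≤D⇒d/1≤D/3 (degree e′) D (≡.subst (λ d → 3 ℕ.* d ℕ.≤ D) (≡.sym degree-e′) 3e≤D))

-- Finite fields and the indicator polynomial of the solutions.

HasCardinality⇒≈? : ∀ {a ℓ k} (S : Setoid a ℓ) → HasCardinality S k → Decidable (Setoid._≈_ S)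
HasCardinality⇒≈? S fin x y = map′
  (λ eq → S.trans (S.sym (strictlyInverseʳ x)) (S.trans (from-cong eq) (strictlyInverseʳ y)))
  to-cong (to x ≟ to y)
  where
  module S = Setoid S
  open Inverse fin

module FiniteField {c ℓ₁ ℓ₂} (F : HeytingField c ℓ₁ ℓ₂) {k : ℕ}
  (finite : HasCardinality (FieldVectors.fieldSetoid F) (suc k)) where

  open HeytingField F using (heytingCommutativeRing; tight; #⇒invertible)
  open Algebra.Apartness.Properties.HeytingCommutativeRing heytingCommutativeRing using (1#0; x-0≈x)

  commutativeRing : CommutativeRing c ℓ₁
  commutativeRing = record { isCommutativeRing = HeytingField.isCommutativeRing F }

  open CommutativeRing commutativeRing hiding (zero)
  open Polynomials commutativeRing
  open import Algebra.Properties.Ring ring using (-‿distribˡ-*)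
  open import Relation.Binary.Reasoning.Setoid setoid
  open Inverse finite

  infix 4 _≈?_

  _≈?_ : Decidable _≈_
  _≈?_ = HasCardinality⇒≈? setoid finite

  -- An inverse is sought among the finitely many elements. If there is none, x cannot be apart from
  -- 0, and tightness makes it equal to 0.
  zero⊎unit : ∀ x → x ≈ 0# ⊎ ∃ λ y → x * y ≈ 1#
  zero⊎unit x with any? (λ i → x * from i ≈? 1#)
  ... | yes (i , x*y≈1) = inj₂ (from i , x*y≈1)
  ... | no ∄inverse = inj₁ (proj₁ (tight x 0#) λ x#0 →
    let (y , _ , x-0*y≈1) = #⇒invertible x#0 in
    ∄inverse (to y , trans (*-cong (sym (x-0≈x x)) (strictlyInverseʳ y)) x-0*y≈1))

  1≉0 : ¬ 1# ≈ 0#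
  1≉0 1≈0 = proj₂ (tight 1# 0#) 1≈0 1#0

  private
    -- Skipping the index of 0 leaves q - 1 indices, whence the degree of `zeroIndicator`.
    nonzero : Fin k → Carrier
    nonzero j = from (punchIn (to 0#) j)

    nonzero-unit : ∀ j → ∃ λ y → nonzero j * y ≈ 1#
    nonzero-unit j with zero⊎unit (nonzero j)
    ... | inj₂ unit  = unit
    ... | inj₁ c≈0   = contradiction
      (≡.trans (≡.sym (strictlyInverseˡ _)) (to-cong c≈0)) (punchInᵢ≢i (to 0#) j)

    negInverse : Fin k → Carrier
    negInverse j = - proj₁ (nonzero-unit j)

  zeroIndicator : Carrier → Carrier
  zeroIndicator w = product λ j → 1# + negInverse j * w

  zeroIndicator-zero : ∀ {w} → w ≈ 0# → zeroIndicator w ≈ 1#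
  zeroIndicator-zero w≈0 = product-one {k} _ λ j →
    trans (+-congˡ (trans (*-congˡ w≈0) (zeroʳ _))) (+-identityʳ 1#)

  -- The factor belonging to c = w is 1 - w / w.
  zeroIndicator-nonzero : ∀ {w} → ¬ w ≈ 0# → zeroIndicator w ≈ 0#
  zeroIndicator-nonzero {w} w≉0 = product-zero {k} j _ (begin
    1# + - y * w      ≈⟨ +-congˡ (-‿distribˡ-* y w) ⟨
    1# + - (y * w)    ≈⟨ +-congˡ (-‿cong (trans (*-comm y w) (*-congʳ w≈c))) ⟩
    1# + - (c′ * y)   ≈⟨ +-congˡ (-‿cong (proj₂ (nonzero-unit j))) ⟩
    1# + - 1#         ≈⟨ -‿inverseʳ 1# ⟩
    0#                ∎)
    where
    0≢w : to 0# ≢ to w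
    0≢w eq = w≉0 (trans (sym (strictlyInverseʳ w)) (trans (from-cong (≡.sym eq)) (strictlyInverseʳ 0#)))
    j = punchOut 0≢w
    c′ = nonzero j
    y = proj₁ (nonzero-unit j)
    w≈c : w ≈ c′
    w≈c = trans (sym (strictlyInverseʳ w)) (from-cong (≡.sym (punchIn-punchOut 0≢w)))

  module _ {n : ℕ} (α β γ : Carrier) where

    form : Vector Carrier n → Vector Carrier n → Vector Carrier n → Vector Carrier n
    form x y z i = α * x i + β * y i + γ * z i

    solutionIndicator : Triple (Vector Carrier n) → Carrier
    solutionIndicator (x , y , z) = product λ i → zeroIndicator (form x y z i)

    solutionIndicator-solution : ∀ {x y z} →
      (∀ i → form x y z i ≈ 0#) → solutionIndicator (x , y , z) ≈ 1#
    solutionIndicator-solution eqs = product-one {n} _ λ i → zeroIndicator-zero (eqs i)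

    -- Decidable equality turns the negated universal statement into a coordinate where the form is
    -- nonzero, and the factor there vanishes.
    solutionIndicator-nonsolution : ∀ {x y z} →
      ¬ (∀ i → form x y z i ≈ 0#) → solutionIndicator (x , y , z) ≈ 0#
    solutionIndicator-nonsolution {x} {y} {z} ¬eqs =
      let (i , ≉0) = ¬∀⟶∃¬ n _ (λ i → form x y z i ≈? 0#) ¬eqs in
      product-zero {n} i _ (zeroIndicator-nonzero ≉0)

    solutionIndicator-spanned : Spanned (Monomialₙ (suc k) n (n ℕ.* k)) solutionIndicator
    solutionIndicator-spanned = product-spannedₙ n _ λ i →
      product-spanned₁ k _ λ j → linear-factor-spanned α β γ (negInverse j)

-- The bound on the size of the solution-free set.

open import Data.Nat.Base using (_*_; _∸_; _≤_)

theorem4 : ∀ {c ℓ₁ ℓ₂ p} (F : HeytingField c ℓ₁ ℓ₂) →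
    let module F = HeytingField F
        open FieldVectors F
    in
    (q : ℕ) → HasCardinality fieldSetoid q →
    (n : ℕ) → .{{_ : NonZero n}} →
    (α β γ : F.Carrier) → (α F.+ β F.+ γ) F.≈ F.0# → ¬ (γ F.≈ F.0#) →
    (A : Pred (Vector F.Carrier n) p) → A Respects _≋_ →
    OnlyTrivialSolutions α β γ A →
    (∣A∣ : ℕ) → HasCardinality (subsetSetoid (≋-setoid n) A) ∣A∣ →
    ∣A∣ ≤ 3 * m q n ((+ ((q ∸ 1) * n)) / 3)
-- A field is inhabited by 0, so q is a successor and q - 1 is `k`.
theorem4 F zero finite with () ← Inverse.to finite (HeytingField.0# F)
theorem4 F (suc k) finite n α β γ α+β+γ≈0 _ A _ trivial ∣A∣ A-finite =
  -- The product by 3 unfolds to M + (M + (M + 0)).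
  ≡.subst (λ s → ∣A∣ ≤ M ℕ.+ (M ℕ.+ s)) (≡.sym (ℕ.+-identityʳ M))
    (slice-rank (λ j x → u j (point x))
      (λ j y z → f j (point y) (point z))
      (λ j x z → g j (point x) (point z))
      (λ j x y → h j (point x) (point y))
      (λ x T≈0 → 1≉0 (begin
        1#                                                       ≈⟨ solutionIndicator-solution α β γ (diagonal x) ⟨
        solutionIndicator α β γ (point x , point x , point x)    ≈⟨ sliced _ _ _ ⟩
        _                                                        ≈⟨ T≈0 ⟩
        0#                                                       ∎))
      (λ ¬x≡y≡z → trans (sym (sliced _ _ _))
        (solutionIndicator-nonsolution α β γ (¬x≡y≡z ∘ off-diagonal))))
  where
  open FiniteField F finite
  open CommutativeRing commutativeRing hiding (zero) renaming (_*_ to _*F_)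
  open Polynomials commutativeRing
  open SliceRank commutativeRing zero⊎unit 1≉0
  open FieldVectors F
  open Inverse A-finite
  open import Relation.Binary.Reasoning.Setoid setoid

  M : ℕ
  M = m (suc k) n ((+ (k * n)) / 3)

  u : Fin M → Vector Carrier n → Carrier
  u j = monomial (lookup (filter (λ e → (+ degree e) / 1 ≤? (+ (k * n)) / 3) (exponentTuples (suc k) n)) j)

  low : ∀ (e : Vector (Fin (suc k)) n) → 3 * degree e ≤ n * k → ∃ λ j → ∀ x → monomial e x ≈ u j x
  low e 3e≤D =
    let (j , eq) = low-degree-index (k * n) e (≡.subst (3 * degree e ≤_) (ℕ.*-comm n k) 3e≤D) in
    j , λ x → product-cong λ i → reflexive (≡.cong (λ d → x i ^ toℕ d) (≡.sym (eq i)))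
    where open import Algebra.Properties.Semiring.Exp semiring using (_^_)

  open Sliced (Spanned⇒Sliced u low (solutionIndicator-spanned {n} α β γ)) renaming (equation to sliced)

  point : Fin ∣A∣ → Vector Carrier n
  point x = proj₁ (from x)

  -- Equality in the subset compares only the underlying vectors, so equal vectors have equal
  -- indices whatever the membership proofs.
  point-injective : ∀ {x y} → point x ≋ point y → x ≡ y
  point-injective {x} {y} eq =
    ≡.trans (≡.sym (strictlyInverseˡ x)) (≡.trans (to-cong eq) (strictlyInverseˡ y))

  diagonal : ∀ x i → form α β γ (point x) (point x) (point x) i ≈ 0#
  diagonal x i = begin
    α *F a + β *F a + γ *F a    ≈⟨ +-congʳ (distribʳ a α β) ⟨
    (α + β) *F a + γ *F a       ≈⟨ distribʳ a (α + β) γ ⟨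
    (α + β + γ) *F a            ≈⟨ *-congʳ α+β+γ≈0 ⟩
    0# *F a                     ≈⟨ zeroˡ a ⟩
    0#                          ∎
    where a = point x i

  -- The hypothesis on A, carried over to indices.
  off-diagonal : ∀ {x y z} → (∀ i → form α β γ (point x) (point y) (point z) i ≈ 0#) → x ≡ y × y ≡ z
  off-diagonal {x} {y} {z} eqs =
    let (x≋y , y≋z) = trivial (proj₂ (from x)) (proj₂ (from y)) (proj₂ (from z)) eqs in
    point-injective x≋y , point-injective y≋z
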